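{- Let $r\ge 2$ and $h\ge 1$ be integers and let $T$ be the perfect $r$-ary tree with $h$ levels. For any integer $k\ge 1$, any vertex $v\in V(T)$, and any leaf $\ell$ of $T$, we have $|\mathcal{I}_T^k(v)|\le |\mathcal{I}_T^k(\ell)|$.
   Context: For an integer $r\ge 2$, the perfect $r$-ary tree with $h$ levels is the rooted tree in which every non-leaf vertex has exactly $r$ children and which has exactly $r^{h-1}$ leaves, all at distance $h-1$ from the root. Its leaves are the vertices at distance $h-1$ from the root. For a graph $G$, a set $I\subseteq V(G)$ is independent if no two vertices of $I$ are adjacent; $\mathcal{I}_G^k$ denotes the family of all independent sets of size $k$ in $G$, and for $v\in V(G)$, $\mathcal{I}_G^k(v)=\{A\in\mathcal{I}_G^k : v\in A\}$ (the star with centre $v$). -}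

module Defs where

open import Data.Nat using (ℕ; zero; suc; _+_; _*_; _≤_; _∸_)
import Data.Nat as ℕ
open import Data.Fin using (Fin; toℕ)
open import Data.Fin.Properties using (all?; any?)
open import Data.Fin.Subset using (Subset; _∈_; ∣_∣)
open import Data.Fin.Subset.Properties using (_∈?_)
open import Data.Bool using (Bool; true; false)
open import Data.Vec using (Vec; []; _∷_)
open import Data.List using (List; []; _∷_; map; _++_; length; filter)
open import Data.Product using (Σ; _×_; _,_)
open import Data.Sum using (_⊎_)
open import Relation.Nullary using (¬_; Dec; _→-dec_; _×-dec_; _⊎-dec_; ¬?)
open import Relation.Binary.PropositionalEquality using (_≡_)

size : ℕ → ℕ → ℕ
size r zero    = 0
size r (suc h) = suc (r * size r h)

-- Vertices of the perfect r-ary tree with h levels are Fin (size r h),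
-- numbered in breadth-first ("heap") order: the root is 0 and the
-- children of vertex x are r*x+1, ..., r*x+r.
PTree : ℕ → ℕ → Set
PTree r h = Fin (size r h)

Child : ∀ (r h : ℕ) → PTree r h → PTree r h → Set
Child r h x y = Σ (Fin r) λ c → toℕ y ≡ r * toℕ x + suc (toℕ c)

Adj : ∀ (r h : ℕ) → PTree r h → PTree r h → Set
Adj r h x y = Child r h x y ⊎ Child r h y x

-- Leaves: the vertices at depth h-1, i.e. those numbered
-- size r (h-1), ..., size r h - 1.
IsLeaf : ∀ (r h : ℕ) → PTree r h → Set
IsLeaf r h ℓ = size r (h ∸ 1) ≤ toℕ ℓ

Independent : ∀ (r h : ℕ) → Subset (size r h) → Set
Independent r h A = ∀ x y → x ∈ A → y ∈ A → ¬ Adj r h x y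

child? : ∀ r h x y → Dec (Child r h x y)
child? r h x y = any? (λ c → toℕ y ℕ.≟ r * toℕ x + suc (toℕ c))

adj? : ∀ r h x y → Dec (Adj r h x y)
adj? r h x y = child? r h x y ⊎-dec child? r h y x

independent? : ∀ r h A → Dec (Independent r h A)
independent? r h A =
  all? (λ x → all? (λ y → (x ∈? A) →-dec ((y ∈? A) →-dec ¬? (adj? r h x y))))

allSubsets : (n : ℕ) → List (Subset n)
allSubsets zero    = [] ∷ []
allSubsets (suc n) = map (false ∷_) (allSubsets n) ++ map (true ∷_) (allSubsets n)

InStar : ∀ (r h k : ℕ) → PTree r h → Subset (size r h) → Set
InStar r h k v A = Independent r h A × ∣ A ∣ ≡ k × v ∈ A

inStar? : ∀ r h k v A → Dec (InStar r h k v A)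
inStar? r h k v A = independent? r h A ×-dec ((∣ A ∣ ℕ.≟ k) ×-dec (v ∈? A))

starSize : ∀ (r h k : ℕ) → PTree r h → ℕ
starSize r h k v = length (filter (inStar? r h k v) (allSubsets (size r h)))

{-# OPTIONS --safe #-}
module Submission where

-- Let P h and Q h be the independence polynomials of the perfect r-ary tree with h
-- levels and of that tree without its root.  The fractions Q h / P h alternate: even
-- ones decrease, odd ones increase, and every even one exceeds every odd one
-- (coefficientwise, after clearing denominators).  Summing out the branches hanging off
-- the path from the root to a leaf leaves a path whose vertex at height i has weight
-- X (Q i / P i)^(r−1), and the alternation shows that at least as many weighted
-- independent sets of the path avoid its top as avoid its bottom.  Hence the star of the
-- root is at most that of a leaf.  For an arbitrary v, apply this to the subtree below v.

open import Defs
open import Algebra.Bundles using (CommutativeSemiring)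
import Algebra.Properties.CommutativeSemiring.Exp as Exp
import Algebra.Solver.Ring.NaturalCoefficients.Default as Solver
open import Algebra.Structures.Biased using (isCommutativeSemiringˡ)
open import Data.Bool using (Bool; true; false; _∧_; _∨_; not)
import Data.Bool.Properties as Bool
open import Data.Fin as Fin using (Fin; zero; suc; toℕ; fromℕ<)
import Data.Fin.Properties as Fin
open import Data.Fin.Subset as Subset using (Subset; ∣_∣)
open import Data.Fin.Subset.Properties using (_∈?_)
open import Data.List as List using (List; []; _∷_; _++_; _∷ʳ_; map; concat; tabulate; allFin; length; filter; null)
open import Data.List.Membership.Propositional using (_∈_)
open import Data.List.Membership.Propositional.Properties using (∈-map⁺; ∈-map⁻; ∈-concat⁺′; ∈-concat⁻′; ∈-tabulate⁺; ∈-tabulate⁻; ∈-allFin)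
open import Data.List.Membership.Propositional.Properties.WithK using (unique∧set⇒bag)
import Data.List.Properties as List
open import Data.List.Relation.Binary.BagAndSetEquality using (∼bag⇒↭)
open import Data.List.Relation.Binary.Disjoint.Propositional using (Disjoint)
open import Data.List.Relation.Binary.Permutation.Propositional as ↭ using (_↭_; prep; swap)
import Data.List.Relation.Unary.All as All
import Data.List.Relation.Unary.All.Properties as All
open import Data.List.Relation.Unary.AllPairs using ([]; _∷_)
import Data.List.Relation.Unary.AllPairs.Properties as AllPairs
open import Data.List.Relation.Unary.Any using (here; there)
open import Data.List.Relation.Unary.Unique.Propositional using (Unique)
import Data.List.Relation.Unary.Unique.Propositional.Properties as Unique
open import Data.Nat as ℕ using (ℕ; zero; suc; _≤_; z≤n; s≤s)
import Data.Nat.DivMod as ℕ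
import Data.Nat.Properties as ℕ
open import Data.Nat.Tactic.RingSolver using (solve-∀)
open import Data.Product using (∃; _×_; _,_; proj₁; proj₂)
open import Data.Sum using (inj₁; inj₂)
open import Data.Vec using ([]; _∷_; here; there)
open import Function using (_∘_; id; const)
open import Function.Bundles using (mk⇔)
open import Level using (0ℓ)
open import Relation.Binary.Bundles using (Preorder)
open import Relation.Binary.PropositionalEquality as ≡ using (_≡_; _≢_; cong; cong₂)
open import Relation.Binary.Structures using (IsEquivalence)
open import Relation.Nullary using (¬_; Dec; yes; no; does; contradiction)
open import Relation.Nullary.Decidable using (dec-true; dec-false; does-⇔)
open import Relation.Unary using (Decidable)

-- Formal power series with coefficients in ℕ

Series : Set
Series = ℕ → ℕ

infix 4 _≈_ _≼_
infixl 6 _⊕_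
infixl 7 _⊛_

-- A record, not a bare function type, so that both series can be inferred from a proof.
record _≈_ (f g : Series) : Set where
  constructor pointwise
  field at : ∀ k → f k ≡ g k
open _≈_

record _≼_ (f g : Series) : Set where
  constructor pointwise
  field at : ∀ k → f k ≤ g k
open _≼_ using () renaming (at to ≼-at)

tail : ∀ {A : Set} → (ℕ → A) → ℕ → A
tail f k = f (suc k)

zeroˢ oneˢ X : Series
zeroˢ k = 0
oneˢ zero    = 1
oneˢ (suc k) = 0
X zero    = 0
X (suc k) = oneˢ k

-- `⊛` is the Cauchy product, peeling the constant term off the left factor so that its laws follow
-- by induction on the degree.
_⊕_ _⊛_ : Series → Series → Series
(f ⊕ g) k = f k ℕ.+ g k
(f ⊛ g) zero    = f 0 ℕ.* g 0
(f ⊛ g) (suc k) = f 0 ℕ.* g (suc k) ℕ.+ (tail f ⊛ g) k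

⊛-cong : ∀ {f f′ g g′} → f ≈ f′ → g ≈ g′ → f ⊛ g ≈ f′ ⊛ g′
⊛-cong p q = pointwise (go p q)
  where
  go : ∀ {f f′ g g′} → f ≈ f′ → g ≈ g′ → ∀ k → (f ⊛ g) k ≡ (f′ ⊛ g′) k
  go p q zero    = cong₂ ℕ._*_ (at p 0) (at q 0)
  go p q (suc k) = cong₂ ℕ._+_ (cong₂ ℕ._*_ (at p 0) (at q (suc k)))
                     (go (pointwise (at p ∘ suc)) q k)

⊛-sucʳ : ∀ f g k → (f ⊛ g) (suc k) ≡ f (suc k) ℕ.* g 0 ℕ.+ (f ⊛ tail g) k
⊛-sucʳ f g zero    = ℕ.+-comm (f 0 ℕ.* g 1) (f 1 ℕ.* g 0)
⊛-sucʳ f g (suc k) = ≡.trans (cong (f 0 ℕ.* g (suc (suc k)) ℕ.+_) (⊛-sucʳ (tail f) g k))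
  (lemma (f 0 ℕ.* g (suc (suc k))) (f (suc (suc k)) ℕ.* g 0) _)
  where
  lemma : ∀ a b c → a ℕ.+ (b ℕ.+ c) ≡ b ℕ.+ (a ℕ.+ c)
  lemma = solve-∀

⊛-comm : ∀ f g k → (f ⊛ g) k ≡ (g ⊛ f) k
⊛-comm f g zero    = ℕ.*-comm (f 0) (g 0)
⊛-comm f g (suc k) = ≡.trans
  (cong₂ ℕ._+_ (ℕ.*-comm (f 0) (g (suc k))) (⊛-comm (tail f) g k))
  (≡.sym (⊛-sucʳ g f k))

⊛-distribʳ : ∀ h f g k → ((f ⊕ g) ⊛ h) k ≡ (f ⊛ h) k ℕ.+ (g ⊛ h) k
⊛-distribʳ h f g zero    = ℕ.*-distribʳ-+ (h 0) (f 0) (g 0)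
⊛-distribʳ h f g (suc k) = ≡.trans
  (cong ((f 0 ℕ.+ g 0) ℕ.* h (suc k) ℕ.+_) (⊛-distribʳ h (tail f) (tail g) k))
  (lemma (f 0) (g 0) (h (suc k)) _ _)
  where
  lemma : ∀ a b c d e → (a ℕ.+ b) ℕ.* c ℕ.+ (d ℕ.+ e) ≡ a ℕ.* c ℕ.+ d ℕ.+ (b ℕ.* c ℕ.+ e)
  lemma = solve-∀

⊛-scaleˡ : ∀ c f g k → ((λ j → c ℕ.* f j) ⊛ g) k ≡ c ℕ.* (f ⊛ g) k
⊛-scaleˡ c f g zero    = ℕ.*-assoc c (f 0) (g 0)
⊛-scaleˡ c f g (suc k) = ≡.trans
  (cong (c ℕ.* f 0 ℕ.* g (suc k) ℕ.+_) (⊛-scaleˡ c (tail f) g k))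
  (lemma c (f 0) (g (suc k)) _)
  where
  lemma : ∀ c a b d → c ℕ.* a ℕ.* b ℕ.+ c ℕ.* d ≡ c ℕ.* (a ℕ.* b ℕ.+ d)
  lemma = solve-∀

⊛-assoc : ∀ f g h k → ((f ⊛ g) ⊛ h) k ≡ (f ⊛ (g ⊛ h)) k
⊛-assoc f g h zero    = ℕ.*-assoc (f 0) (g 0) (h 0)
⊛-assoc f g h (suc k) = ≡.trans
  (cong (f 0 ℕ.* g 0 ℕ.* h (suc k) ℕ.+_)
    (≡.trans (⊛-distribʳ h (λ j → f 0 ℕ.* g (suc j)) (tail f ⊛ g) k)
      (cong₂ ℕ._+_ (⊛-scaleˡ (f 0) (tail g) h k) (⊛-assoc (tail f) g h k))))
  (lemma (f 0) (g 0) (h (suc k)) _ _)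
  where
  lemma : ∀ a b c d e → a ℕ.* b ℕ.* c ℕ.+ (a ℕ.* d ℕ.+ e) ≡ a ℕ.* (b ℕ.* c ℕ.+ d) ℕ.+ e
  lemma = solve-∀

⊛-zeroˡ : ∀ f k → (zeroˢ ⊛ f) k ≡ 0
⊛-zeroˡ f zero    = ≡.refl
⊛-zeroˡ f (suc k) = ⊛-zeroˡ f k

⊛-identityˡ : ∀ f k → (oneˢ ⊛ f) k ≡ f k
⊛-identityˡ f zero    = ℕ.+-identityʳ (f 0)
⊛-identityˡ f (suc k) = ≡.trans (cong₂ ℕ._+_ (ℕ.+-identityʳ (f (suc k))) (⊛-zeroˡ f k))
                          (ℕ.+-identityʳ (f (suc k)))

series : CommutativeSemiring 0ℓ 0ℓ
series = record
  { Carrier = Series ; _≈_ = _≈_ ; _+_ = _⊕_ ; _*_ = _⊛_ ; 0# = zeroˢ ; 1# = oneˢ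
  ; isCommutativeSemiring = isCommutativeSemiringˡ (record
    { +-isCommutativeMonoid = record
      { isMonoid = record
        { isSemigroup = record
          { isMagma = record { isEquivalence = ≈-equiv
                             ; ∙-cong = λ p q → pointwise λ k → cong₂ ℕ._+_ (at p k) (at q k) }
          ; assoc = λ f g h → pointwise λ k → ℕ.+-assoc (f k) (g k) (h k) }
        ; identity = (λ f → pointwise λ k → ≡.refl)
                   , (λ f → pointwise λ k → ℕ.+-identityʳ (f k)) }
      ; comm = λ f g → pointwise λ k → ℕ.+-comm (f k) (g k) }
    ; *-isCommutativeMonoid = record
      { isMonoid = record
        { isSemigroup = record
          { isMagma = record { isEquivalence = ≈-equiv ; ∙-cong = ⊛-cong }
          ; assoc = λ f g h → pointwise (⊛-assoc f g h) }
        ; identity = (λ f → pointwise (⊛-identityˡ f))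
                   , (λ f → pointwise λ k → ≡.trans (⊛-comm f oneˢ k) (⊛-identityˡ f k)) }
      ; comm = λ f g → pointwise (⊛-comm f g) }
    ; distribʳ = λ h f g → pointwise (⊛-distribʳ h f g)
    ; zeroˡ = λ f → pointwise (⊛-zeroˡ f) })
  }
  where
  ≈-equiv : IsEquivalence _≈_
  ≈-equiv = record
    { refl  = pointwise λ _ → ≡.refl
    ; sym   = λ p → pointwise λ k → ≡.sym (at p k)
    ; trans = λ p q → pointwise λ k → ≡.trans (at p k) (at q k) }

open CommutativeSemiring series hiding (_≈_; zero)
open Exp series using (_^_; ^-distrib-*)
open Solver series using (solve; _:=_; _:+_; _:*_; con)

X*-suc : ∀ f k → (X * f) (suc k) ≡ f k
X*-suc f k = ⊛-identityˡ f k

-- The coefficientwise order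

≼-preorder : Preorder 0ℓ 0ℓ 0ℓ
≼-preorder = record
  { Carrier = Series ; _≈_ = _≈_ ; _≲_ = _≼_
  ; isPreorder = record
    { isEquivalence = isEquivalence
    ; reflexive = λ p → pointwise λ k → ℕ.≤-reflexive (at p k)
    ; trans = λ p q → pointwise λ k → ℕ.≤-trans (≼-at p k) (≼-at q k) } }

open Preorder ≼-preorder using ()
  renaming (reflexive to ≼-reflexive; refl to ≼-refl; trans to ≼-trans)

import Relation.Binary.Reasoning.Preorder ≼-preorder as ≼-Reasoning

+-mono : ∀ {f f′ g g′} → f ≼ f′ → g ≼ g′ → f + g ≼ f′ + g′
+-mono p q = pointwise λ k → ℕ.+-mono-≤ (≼-at p k) (≼-at q k)

*-mono : ∀ {f f′ g g′} → f ≼ f′ → g ≼ g′ → f * g ≼ f′ * g′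
*-mono p q = pointwise (go p q)
  where
  go : ∀ {f f′ g g′} → f ≼ f′ → g ≼ g′ → ∀ k → (f * g) k ≤ (f′ * g′) k
  go p q zero    = ℕ.*-mono-≤ (≼-at p 0) (≼-at q 0)
  go p q (suc k) = ℕ.+-mono-≤ (ℕ.*-mono-≤ (≼-at p 0) (≼-at q (suc k)))
                     (go (pointwise (≼-at p ∘ suc)) q k)

^-mono : ∀ {f g} n → f ≼ g → f ^ n ≼ g ^ n
^-mono zero    p = ≼-refl
^-mono (suc n) p = *-mono p (^-mono n p)

0≼ : ∀ f → 0# ≼ f
0≼ f = pointwise λ _ → z≤n

f≼f+g : ∀ f g → f ≼ f + g
f≼f+g f g = pointwise λ k → ℕ.m≤m+n (f k) (g k)

-- Stands in for subtraction: of two splittings of one total, the larger first part leaves the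
-- smaller rest.
+-cancel-≼ : ∀ {a b c d} → a + b ≈ c + d → c ≼ a → b ≼ d
+-cancel-≼ {a} {b} {c} {d} eq c≼a = pointwise λ k →
  ℕ.+-cancelˡ-≤ (a k) (b k) (d k)
    (ℕ.≤-trans (ℕ.≤-reflexive (at eq k)) (ℕ.+-monoˡ-≤ (d k) (≼-at c≼a k)))

-- Alternating comparisons

Cmp : Bool → Series → Series → Set
Cmp true  f g = g ≼ f
Cmp false f g = f ≼ g

-- Flipping by recursion instead of a parity test makes `Alt e (suc n)` unfold to `Alt (not e) n`
-- when indices shift by one.
Alt : Bool → ℕ → Series → Series → Set
Alt e zero    = Cmp e
Alt e (suc n) = Alt (not e) n

Cmp-resp : ∀ e {f f′ g g′} → f ≈ f′ → g ≈ g′ → Cmp e f g → Cmp e f′ g′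
Cmp-resp true  p q c = ≼-trans (≼-reflexive (sym q)) (≼-trans c (≼-reflexive p))
Cmp-resp false p q c = ≼-trans (≼-reflexive (sym p)) (≼-trans c (≼-reflexive q))

Cmp-refl : ∀ e {f} → Cmp e f f
Cmp-refl true  = ≼-refl
Cmp-refl false = ≼-refl

Cmp-+ˡ : ∀ e h {f g} → Cmp e f g → Cmp e (h + f) (h + g)
Cmp-+ˡ true  h c = +-mono (≼-refl {h}) c
Cmp-+ˡ false h c = +-mono (≼-refl {h}) c

Cmp-*ˡ : ∀ e h {f g} → Cmp e f g → Cmp e (h * f) (h * g)
Cmp-*ˡ true  h c = *-mono (≼-refl {h}) c
Cmp-*ˡ false h c = *-mono (≼-refl {h}) c

Cmp-* : ∀ e {f f′ g g′} → Cmp e f g → Cmp e f′ g′ → Cmp e (f * f′) (g * g′)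
Cmp-* true  = *-mono
Cmp-* false = *-mono

Cmp-^ : ∀ e n {f g} → Cmp e f g → Cmp e (f ^ n) (g ^ n)
Cmp-^ true  n = ^-mono n
Cmp-^ false n = ^-mono n

Cmp-flip : ∀ e {f g} → Cmp (not e) f g → Cmp e g f
Cmp-flip true  c = c
Cmp-flip false c = c

Alt-map : ∀ {f g f′ g′} → (∀ e → Cmp e f g → Cmp e f′ g′) → ∀ e n → Alt e n f g → Alt e n f′ g′
Alt-map φ e zero    = φ e
Alt-map φ e (suc n) = Alt-map φ (not e) n

Alt-flip : ∀ e n {f g} → Alt e n f g → Alt (not e) n g f
Alt-flip true  zero    c = c
Alt-flip false zero    c = c
Alt-flip e     (suc n) c = Alt-flip (not e) n c

-- Weighted path sums.  Position i of a path carries weight y i if it is outside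
-- and z i if it is inside an independent set; U sums over positions 0 … m−1,
-- and U⁰ restricts to sets avoiding the top position m−1.

U U⁰ : (y z : ℕ → Series) → ℕ → Series
U  y z zero    = 1#
U  y z (suc m) = y m * U y z m + z m * U⁰ y z m
U⁰ y z zero    = 1#
U⁰ y z (suc m) = y m * U y z m

-- The same sums over positions 0 … m, restricted to sets containing position 0.
B B⁰ : (y z : ℕ → Series) → ℕ → Series
B  y z zero    = z 0
B  y z (suc m) = y (suc m) * B y z m + z (suc m) * B⁰ y z m
B⁰ y z zero    = 0#
B⁰ y z (suc m) = y (suc m) * B y z m

-- `U` and `U⁰` peel positions off the top; here the sets are sorted by the bottom one, and leaving
-- it out shifts the weights by `tail`. The two equations go together because `U` recurs through
-- `U⁰`.
U-split-bottom : ∀ y z m →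
  (U  y z (suc m) ≈ y 0 * U  (tail y) (tail z) m + B  y z m) ×
  (U⁰ y z (suc m) ≈ y 0 * U⁰ (tail y) (tail z) m + B⁰ y z m)
U-split-bottom y z zero =
  solve 2 (λ a b → a :* con 1 :+ b :* con 1 := a :* con 1 :+ b) refl (y 0) (z 0) ,
  sym (+-identityʳ _)
U-split-bottom y z (suc m) with U-split-bottom y z m
... | p , q =
  trans (+-cong (*-congˡ p) (*-congˡ q))
    (solve 7 (λ a b c u b₁ v b₂ →
        a :* (c :* u :+ b₁) :+ b :* (c :* v :+ b₂)
        := c :* (a :* u :+ b :* v) :+ (a :* b₁ :+ b :* b₂))
      refl (y (suc m)) (z (suc m)) (y 0) _ _ _ _) ,
  trans (*-congˡ p)
    (solve 4 (λ a c u b → a :* (c :* u :+ b) := c :* (a :* u) :+ a :* b)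
      refl (y (suc m)) (y 0) _ _)

-- Position 0 being occupied forces position 1 to be empty, and the positions above 1 then form a
-- path of their own.
B-suc : ∀ y z m →
  (B  y z (suc m) ≈ z 0 * (y 1 * U  (tail (tail y)) (tail (tail z)) m)) ×
  (B⁰ y z (suc m) ≈ z 0 * (y 1 * U⁰ (tail (tail y)) (tail (tail z)) m))
B-suc y z zero =
  solve 3 (λ a b c → a :* b :+ c :* con 0 := b :* (a :* con 1)) refl (y 1) (z 0) (z 1) ,
  solve 2 (λ a b → a :* b := b :* (a :* con 1)) refl (y 1) (z 0)
B-suc y z (suc m) with B-suc y z m
... | p , q =
  trans (+-cong (*-congˡ p) (*-congˡ q))
    (solve 6 (λ a b c d u v →
        a :* (c :* (d :* u)) :+ b :* (c :* (d :* v)) := c :* (d :* (a :* u :+ b :* v)))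
      refl (y (suc (suc m))) (z (suc (suc m))) (z 0) (y 1) _ _) ,
  trans (*-congˡ p)
    (solve 4 (λ a c d u → a :* (c :* (d :* u)) := c :* (d :* (a :* u)))
      refl (y (suc (suc m))) (z 0) (y 1) _)

-- Both sides are sums over the window 0 … m in which an end position is left out.
-- The sets avoiding both ends cancel, which leaves the same comparison, with the
-- roles exchanged, on the window 1 … m − 1.
U-shift : ∀ e y z →
  (∀ a b → a ≤ b → Alt e a (z a * y b) (z b * y a)) →
  ∀ m → Cmp e (y m * U y z m) (y 0 * U (tail y) (tail z) m)
U-shift e y z H zero = Cmp-refl e
U-shift e y z H (suc zero) = Cmp-resp e
  (solve 3 (λ a b c → a :* b :+ c :* b := b :* (a :* con 1 :+ c :* con 1))
    refl (y 0) (y 1) (z 0))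
  (solve 3 (λ a b c → a :* b :+ c :* a := a :* (b :* con 1 :+ c :* con 1))
    refl (y 0) (y 1) (z 1))
  (Cmp-+ˡ e (y 0 * y 1) (H 0 1 z≤n))
U-shift e y z H (suc (suc m)) = Cmp-resp e
  (trans (solve 6 (λ a b c d u v →
             b :* (a :* u) :+ (c :* b) :* (d :* v) := b :* (a :* u :+ c :* (d :* v)))
           refl (y 0) (y (suc (suc m))) (z 0) (y 1)
             (U (tail y) (tail z) (suc m)) (U (tail (tail y)) (tail (tail z)) m))
         (*-congˡ (sym (trans (proj₁ (U-split-bottom y z (suc m)))
                              (+-congˡ (proj₁ (B-suc y z m)))))))
  (solve 6 (λ a b c d u v →
      b :* (a :* u) :+ (c :* a) :* (d :* v) := a :* (b :* u :+ c :* (d :* v)))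
    refl (y 0) (y (suc (suc m))) (z (suc (suc m))) (y (suc m))
      (U (tail y) (tail z) (suc m)) (U (tail y) (tail z) m))
  (Cmp-+ˡ e _
    (Cmp-* e (H 0 (suc (suc m)) z≤n)
      (Cmp-flip e (U-shift (not e) (tail y) (tail z)
                     (λ a b a≤b → H (suc a) (suc b) (s≤s a≤b)) m))))

-- Independence polynomials of perfect (s+1)-ary trees: P h counts all independent
-- sets of the tree with h levels, Q h those avoiding the root.

module Polynomials (s : ℕ) where

  r : ℕ
  r = suc s

  P Q : ℕ → Series
  P zero    = 1#
  P (suc h) = P h ^ r + X * Q h ^ r
  Q zero    = 1#
  Q (suc h) = P h ^ r

  Q≼P : ∀ h → Q h ≼ P h
  Q≼P zero    = ≼-refl
  Q≼P (suc h) = f≼f+g _ _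

  -- The recursion gives `Q (suc h) / P (suc h)` = 1 / (1 + `X` (`Q h / P h`)^`r`), which is
  -- decreasing in `Q h / P h`, so each level reverses the comparison. It starts from `Q b / P b`
  -- being at most 1.
  QP-alternates : ∀ a b → a ≤ b → Alt true a (Q a * P b) (Q b * P a)
  QP-alternates zero    b       a≤b = begin
    Q b * 1#  ≈⟨ *-comm _ _ ⟩
    1# * Q b  ≲⟨ *-mono (≼-refl {1#}) (Q≼P b) ⟩
    1# * P b  ∎
    where open ≼-Reasoning
  QP-alternates (suc a) (suc b) (s≤s a≤b) =
    -- Expanded, both sides share `P a ^ r * P b ^ r`; the rest is `X` times `r`-th powers of the
    -- products one level down, with the sides exchanged.
    Alt-map (λ e c → Cmp-resp e
        (trans (+-congˡ (*-congˡ (^-distrib-* (Q b) (P a) r)))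
          (solve 4 (λ p q t x → p :* q :+ x :* (t :* p) := p :* (q :+ x :* t))
            refl (P a ^ r) (P b ^ r) (Q b ^ r) X))
        (trans (+-congˡ (*-congˡ (^-distrib-* (Q a) (P b) r)))
          (solve 4 (λ p q t x → p :* q :+ x :* (t :* q) := q :* (p :+ x :* t))
            refl (P a ^ r) (P b ^ r) (Q a ^ r) X))
        (Cmp-+ˡ e (P a ^ r * P b ^ r) (Cmp-*ˡ e X (Cmp-^ e r c))))
      false a (Alt-flip true a (QP-alternates a b a≤b))

  -- For a path vertex with `i` levels below it: each of its `s` branches off the path contributes
  -- `P i` if the vertex is left out, `Q i` if it is taken.
  y z : ℕ → Series
  y i = P i ^ s
  z i = X * Q i ^ s

  zy-alternates : ∀ a b → a ≤ b → Alt true a (z a * y b) (z b * y a)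
  zy-alternates a b a≤b = Alt-map (λ e c → Cmp-resp e
      (trans (*-congˡ (^-distrib-* (Q a) (P b) s)) (sym (*-assoc _ _ _)))
      (trans (*-congˡ (^-distrib-* (Q b) (P a) s)) (sym (*-assoc _ _ _)))
      (Cmp-*ˡ e X (Cmp-^ e s c)))
    true a (QP-alternates a b a≤b)

  -- The path sum recovers the whole tree: `P m ^ r` is `P m ^ s` for the hanging branches times
  -- `P m` for the branch that continues the path, and likewise for `Q`.
  U-PQ : ∀ m → (U y z m ≈ P m) × (U⁰ y z m ≈ Q m)
  U-PQ zero    = refl , refl
  U-PQ (suc m) with U-PQ m
  ... | p , q =
    +-cong (trans (*-congˡ p) (*-comm _ _))
      (trans (*-congˡ q) (trans (*-assoc _ _ _) (*-congˡ (*-comm _ _)))) ,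
    trans (*-congˡ p) (*-comm _ _)

  -- S h n is the star, in the tree with h levels, of a vertex at depth n; S⁰ h n is
  -- the part of it avoiding the root.
  S S⁰ : ℕ → ℕ → Series
  S  zero    n       = 0#
  S  (suc h) zero    = X * Q h ^ r
  S  (suc h) (suc n) = y h * S h n + z h * S⁰ h n
  S⁰ zero    n       = 0#
  S⁰ (suc h) zero    = 0#
  S⁰ (suc h) (suc n) = y h * S h n

  S-leaf : ∀ m → (S (suc m) m ≈ B y z m) × (S⁰ (suc m) m ≈ B⁰ y z m)
  -- The exponents `r` and `s` differ by one factor `Q 0`, which is 1.
  S-leaf zero = *-congˡ (*-identityˡ _) , refl
  S-leaf (suc m) with S-leaf m
  ... | p , q = +-cong (*-congˡ p) (*-congˡ q) , *-congˡ p

  -- The independent sets of the tree split in two ways, according to whether they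
  -- contain the root or the leaf, so it suffices to compare the sets avoiding them.
  root≼leaf : ∀ m → S (suc m) 0 ≼ S (suc m) m
  root≼leaf m = begin
    X * (Q m * Q m ^ s)   ≈⟨ *-congˡ (*-comm _ _) ⟩
    X * (Q m ^ s * Q m)   ≈⟨ *-assoc _ _ _ ⟨
    z m * Q m             ≈⟨ *-congˡ (proj₂ (U-PQ m)) ⟨
    z m * U⁰ y z m        ≲⟨ +-cancel-≼ (proj₁ (U-split-bottom y z m))
                               (U-shift true y z zy-alternates m) ⟩
    B y z m               ≈⟨ proj₁ (S-leaf m) ⟨
    S (suc m) m           ∎
    where open ≼-Reasoning

  -- Each level above the vertex applies the same monotone recursion to both stars, which reduces
  -- the claim to `root≼leaf` in the subtree below the vertex. `S⁰` is carried along because `S`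
  -- recurs through it.
  S≼leaf : ∀ m n → n ≤ m → (S (suc m) n ≼ S (suc m) m) × (S⁰ (suc m) n ≼ S⁰ (suc m) m)
  S≼leaf m       zero    n≤m       = root≼leaf m , 0≼ _
  S≼leaf (suc m) (suc n) (s≤s n≤m) with S≼leaf m n n≤m
  ... | p , q = +-mono (*-mono ≼-refl p) (*-mono ≼-refl q) , *-mono ≼-refl p

-- Independent sets of a graph on a list of vertices

ι : Bool → Series
ι true  = 1#
ι false = 0#

ι-∧ : ∀ a b → ι (a ∧ b) ≈ ι a * ι b
ι-∧ true  b = sym (*-identityˡ _)
ι-∧ false b = sym (zeroˡ _)

module _ {V : Set} where

  infixl 6 _∖_
  _∖_ : (V → Bool) → (V → Bool) → V → Bool
  (i ∖ n) u = i u ∧ not (n u)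

  -- The generating function, by size, of the independent sets A ⊆ vs such that o
  -- holds on vs ∖ A and i holds on A.
  W : (V → V → Bool) → List V → (o i : V → Bool) → Series
  W adj []       o i = 1#
  W adj (v ∷ vs) o i = ι (o v) * W adj vs o i + ι (i v) * (X * W adj vs o (i ∖ adj v))

  W-cong : ∀ {adj adj′} vs {o o′ i i′} → (∀ u v → adj u v ≡ adj′ u v) →
    (∀ {u} → u ∈ vs → o u ≡ o′ u) → (∀ {u} → u ∈ vs → i u ≡ i′ u) →
    W adj vs o i ≈ W adj′ vs o′ i′
  W-cong []       a p q = refl
  W-cong (v ∷ vs) a p q = +-cong
    (*-cong (reflexive (cong ι (p (here ≡.refl)))) (W-cong vs a (p ∘ there) (q ∘ there)))
    (*-cong (reflexive (cong ι (q (here ≡.refl))))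
      (*-congˡ (W-cong vs a (p ∘ there)
        (λ {u} u∈ → cong₂ (λ b c → b ∧ not c) (q (there u∈)) (a v u)))))

  -- Taking `u` and then `v` tests `adj u v`, the other order `adj v u`; symmetry makes them agree,
  -- and the two neighbourhood deletions commute.
  W-↭ : ∀ {adj vs ws o i} → (∀ u v → adj u v ≡ adj v u) → vs ↭ ws →
    W adj vs o i ≈ W adj ws o i
  W-↭ s ↭.refl         = refl
  W-↭ s (prep v p)     = +-cong (*-congˡ (W-↭ s p)) (*-congˡ (*-congˡ (W-↭ s p)))
  W-↭ s (↭.trans p q)  = trans (W-↭ s p) (W-↭ s q)
  W-↭ {adj} {_} {_} {o} {i} s (swap {vs} {ws} u v p) =
    trans (+-cong
        (*-congˡ (+-cong (*-congˡ (W-↭ s p)) (*-congˡ (*-congˡ (W-↭ s p)))))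
        (*-congˡ (*-congˡ (+-cong (*-congˡ (W-↭ s p))
          (*-cong (ι-∧ (i v) _) (*-congˡ (W-↭ s p)))))))
      (trans
        (solve 10 (λ ou ov iu iv n x a b c d →
            ou :* (ov :* a :+ iv :* (x :* b)) :+ iu :* (x :* (ov :* c :+ (iv :* n) :* (x :* d)))
            := ov :* (ou :* a :+ iu :* (x :* c)) :+ iv :* (x :* (ou :* b :+ (iu :* n) :* (x :* d))))
          refl (ι (o u)) (ι (o v)) (ι (i u)) (ι (i v)) (ι (not (adj u v))) X _ _ _ _)
        (+-congˡ (*-congˡ (*-congˡ (+-congˡ (*-cong
          (trans (*-congˡ (reflexive (cong (ι ∘ not) (s u v)))) (sym (ι-∧ (i u) _)))
          (*-congˡ (W-cong ws (λ _ _ → ≡.refl) (λ _ → ≡.refl)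
            (λ {w} _ → comm (i w) (not (adj u w)) (not (adj v w)))))))))))
    where
    comm : ∀ a b c → (a ∧ b) ∧ c ≡ (a ∧ c) ∧ b
    comm a b c = ≡.trans (Bool.∧-assoc a b c)
      (≡.trans (cong (a ∧_) (Bool.∧-comm b c)) (≡.sym (Bool.∧-assoc a c b)))

  -- Taking a vertex of `us` deletes nothing from `vs`, so the choices in the two parts are
  -- independent.
  W-++ : ∀ {adj} us {vs o i} → (∀ {u v} → u ∈ us → v ∈ vs → adj u v ≡ false) →
    W adj (us ++ vs) o i ≈ W adj us o i * W adj vs o i
  W-++ []       a = sym (*-identityˡ _)
  W-++ {adj} (u ∷ us) {vs} {o} {i} a = trans
    (+-cong (*-congˡ (W-++ us (a ∘ there)))
      (*-congˡ (*-congˡ (trans (W-++ us (a ∘ there))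
        (*-congˡ (W-cong vs {i′ = i} (λ _ _ → ≡.refl) (λ _ → ≡.refl)
          (λ {v} v∈ → ≡.trans (cong (λ b → i v ∧ not b) (a (here ≡.refl) v∈))
                              (Bool.∧-identityʳ (i v)))))))))
    (solve 6 (λ p q x b c d → p :* (b :* d) :+ q :* (x :* (c :* d))
                           := (p :* b :+ q :* (x :* c)) :* d)
      refl (ι (o u)) (ι (i u)) X _ _ _)

W-map : ∀ {V V′ : Set} {adj} (f : V′ → V) vs {o i} →
  W adj (map f vs) o i ≡ W (λ u v → adj (f u) (f v)) vs (o ∘ f) (i ∘ f)
W-map f []       = ≡.refl
W-map f (v ∷ vs) = cong₂ (λ a b → _ * a + _ * (X * b)) (W-map f vs) (W-map f vs)

-- Products over branches

∏ : ∀ {n} → (Fin n → Series) → Series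
∏ {zero}  f = 1#
∏ {suc n} f = f zero * ∏ (f ∘ suc)

∏-const : ∀ {n} {f : Fin n → Series} {g} → (∀ c → f c ≈ g) → ∏ f ≈ g ^ n
∏-const {zero}  p = refl
∏-const {suc n} p = *-cong (p zero) (∏-const (p ∘ suc))

∏-cong : ∀ {n} {f g : Fin n → Series} → (∀ c → f c ≈ g c) → ∏ f ≈ ∏ g
∏-cong {zero}  p = refl
∏-cong {suc n} p = *-cong (p zero) (∏-cong (p ∘ suc))

∏-const-except : ∀ {n} (c : Fin (suc n)) {f : Fin (suc n) → Series} {g g′} →
  f c ≈ g′ → (∀ {d} → c ≢ d → f d ≈ g) → ∏ f ≈ g ^ n * g′
∏-const-except {n} zero p q = trans (*-cong p (∏-const {n} (λ d → q λ ()))) (*-comm _ _)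
∏-const-except {suc n} (suc c) p q =
  trans (*-cong (q λ ()) (∏-const-except c p (λ c≢d → q (c≢d ∘ Fin.suc-injective))))
        (sym (*-assoc _ _ _))

W-concat : ∀ {V : Set} {adj} {n} (vss : Fin n → List V) {o i : V → Bool} →
  (∀ {c d u v} → c ≢ d → u ∈ vss c → v ∈ vss d → adj u v ≡ false) →
  W adj (concat (tabulate vss)) o i ≈ ∏ (λ c → W adj (vss c) o i)
W-concat {n = zero}  vss a = refl
W-concat {n = suc n} vss a = trans
  (W-++ (vss zero) (λ u∈ v∈ → let vs , v∈vs , vs∈ = ∈-concat⁻′ (tabulate (vss ∘ suc)) v∈
                                  d , vs≡ = ∈-tabulate⁻ vs∈
                              in a {d = suc d} (λ ()) u∈ (≡.subst (_ ∈_) vs≡ v∈vs)))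
  (*-congˡ (W-concat (vss ∘ suc) (λ c≢d → a (c≢d ∘ Fin.suc-injective))))

-- Counting subsets

count-map : ∀ {A B : Set} {P : B → Set} (P? : Decidable P) (f : A → B) xs →
  length (filter P? (map f xs)) ≡ length (filter (P? ∘ f) xs)
count-map P? f []       = ≡.refl
count-map P? f (x ∷ xs) with does (P? (f x))
... | true  = cong suc (count-map P? f xs)
... | false = count-map P? f xs

count-none : ∀ {A : Set} {P : A → Set} (P? : Decidable P) xs → (∀ x → ¬ P x) →
  length (filter P? xs) ≡ 0
count-none P? xs ¬p = cong length (List.filter-none P? {xs} (All.tabulate (λ {x} _ → ¬p x)))

-- What coefficient `k` of `W` counts, phrased for subsets. With `o` and `i` arbitrary, removing the
-- first vertex stays within the same predicate.
record Counted {n} (adj : Fin n → Fin n → Bool) (o i : Fin n → Bool) (k : ℕ)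
               (A : Subset n) : Set where
  field
    independent : ∀ x y → x Subset.∈ A → y Subset.∈ A → adj x y ≡ false
    size-k      : ∣ A ∣ ≡ k
    outside     : ∀ u → u Subset.∉ A → o u ≡ true
    inside      : ∀ u → u Subset.∈ A → i u ≡ true
open Counted

module _ {n} {adj : Fin (suc n) → Fin (suc n) → Bool} {o i : Fin (suc n) → Bool} where

  private
    adj′ : Fin n → Fin n → Bool
    adj′ x y = adj (suc x) (suc y)

  Counted-false⁻ : ∀ {k A} → Counted adj o i k (false ∷ A) → Counted adj′ (o ∘ suc) (i ∘ suc) k A
  Counted-false⁻ c = record
    { independent = λ x y x∈ y∈ → independent c (suc x) (suc y) (there x∈) (there y∈)
    ; size-k  = size-k c
    ; outside = λ u u∉ → outside c (suc u) (λ { (there u∈) → u∉ u∈ })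
    ; inside  = λ u u∈ → inside c (suc u) (there u∈) }

  Counted-false⁺ : ∀ {k A} → o zero ≡ true → Counted adj′ (o ∘ suc) (i ∘ suc) k A →
    Counted adj o i k (false ∷ A)
  Counted-false⁺ oz c = record
    { independent = λ { (suc x) (suc y) (there x∈) (there y∈) → independent c x y x∈ y∈ }
    ; size-k  = size-k c
    ; outside = λ { zero _ → oz ; (suc u) u∉ → outside c u (u∉ ∘ there) }
    ; inside  = λ { (suc u) (there u∈) → inside c u u∈ } }

  Counted-true⁻ : ∀ {k A} → Counted adj o i (suc k) (true ∷ A) →
    Counted adj′ (o ∘ suc) ((i ∖ adj zero) ∘ suc) k A
  Counted-true⁻ c = record
    { independent = λ x y x∈ y∈ → independent c (suc x) (suc y) (there x∈) (there y∈)
    ; size-k  = ℕ.suc-injective (size-k c)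
    ; outside = λ u u∉ → outside c (suc u) (λ { (there u∈) → u∉ u∈ })
    ; inside  = λ u u∈ → cong₂ (λ a b → a ∧ not b) (inside c (suc u) (there u∈))
                           (independent c zero (suc u) here (there u∈)) }

  -- The restricted `i` records only non-adjacency from `zero` to the other members; irreflexivity
  -- supplies the loop at `zero`, symmetry the reversed pairs.
  Counted-true⁺ : (∀ x → adj x x ≡ false) → (∀ x y → adj x y ≡ adj y x) →
    ∀ {k A} → i zero ≡ true → Counted adj′ (o ∘ suc) ((i ∖ adj zero) ∘ suc) k A →
    Counted adj o i (suc k) (true ∷ A)
  Counted-true⁺ irr symm iz c = record
    { independent = λ
        { zero    zero    _          _          → irr zero
        ; zero    (suc y) _          (there y∈) → nonadj y y∈
        ; (suc x) zero    (there x∈) _          → ≡.trans (symm (suc x) zero) (nonadj x x∈)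
        ; (suc x) (suc y) (there x∈) (there y∈) → independent c x y x∈ y∈ }
    ; size-k  = cong suc (size-k c)
    ; outside = λ { zero u∉ → contradiction here u∉ ; (suc u) u∉ → outside c u (u∉ ∘ there) }
    ; inside  = λ { zero _ → iz ; (suc u) (there u∈) → proj₁ (∧-true _ _ (inside c u u∈)) } }
    where
    ∧-true : ∀ a b → a ∧ not b ≡ true → a ≡ true × b ≡ false
    ∧-true true false _ = ≡.refl , ≡.refl

    nonadj : ∀ y → y Subset.∈ _ → adj zero (suc y) ≡ false
    nonadj y y∈ = proj₂ (∧-true (i (suc y)) _ (inside c y y∈))

-- `allSubsets` and `W` both branch on the first vertex. Allowing any `P` equivalent to `Counted`
-- lets the induction apply to `P?` composed with a cons.
count≡W : ∀ n (adj : Fin n → Fin n → Bool) →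
  (∀ x → adj x x ≡ false) → (∀ x y → adj x y ≡ adj y x) → ∀ o i k →
  {P : Subset n → Set} (P? : Decidable P) →
  (∀ {A} → P A → Counted adj o i k A) → (∀ {A} → Counted adj o i k A → P A) →
  length (filter P? (allSubsets n)) ≡ W adj (allFin n) o i k
count≡W zero adj irr symm o i zero P? to from =
  cong length (List.filter-accept P? (from record
    { independent = λ () ; size-k = ≡.refl ; outside = λ () ; inside = λ () }))
count≡W zero adj irr symm o i (suc k) P? to from =
  cong length (List.filter-reject P? (λ p → contradiction (size-k (to p)) λ ()))
count≡W (suc n) adj irr symm o i k P? to from = begin
  length (filter P? (map (false ∷_) As ++ map (true ∷_) As))
    ≡⟨ cong length (List.filter-++ P? (map (false ∷_) As) _) ⟩
  length (filter P? (map (false ∷_) As) ++ filter P? (map (true ∷_) As))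
    ≡⟨ List.length-++ (filter P? (map (false ∷_) As)) ⟩
  length (filter P? (map (false ∷_) As)) ℕ.+ length (filter P? (map (true ∷_) As))
    ≡⟨ cong₂ ℕ._+_ (≡.trans (count-map P? _ As) (without (o zero) ≡.refl))
                   (≡.trans (count-map P? _ As) (with-zero (i zero) ≡.refl k ≡.refl)) ⟩
  (ι (o zero) * W adj′ (allFin n) (o ∘ suc) (i ∘ suc)) k ℕ.+
  (ι (i zero) * (X * W adj′ (allFin n) (o ∘ suc) ((i ∖ adj zero) ∘ suc))) k
    ≡⟨ cong₂ (λ a b → (ι (o zero) * a) k ℕ.+ (ι (i zero) * (X * b)) k)
         (W-map suc (allFin n)) (W-map suc (allFin n)) ⟨
  (ι (o zero) * W adj (map suc (allFin n)) o i) k ℕ.+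
  (ι (i zero) * (X * W adj (map suc (allFin n)) o (i ∖ adj zero))) k
    ≡⟨ cong (λ vs → W adj (zero ∷ vs) o i k) (List.map-tabulate id suc) ⟩
  W adj (allFin (suc n)) o i k ∎
  where
  open ≡.≡-Reasoning
  As = allSubsets n

  adj′ : Fin n → Fin n → Bool
  adj′ x y = adj (suc x) (suc y)

  rec = count≡W n adj′ (irr ∘ suc) (λ x y → symm (suc x) (suc y)) (o ∘ suc)

  without : ∀ b → o zero ≡ b → length (filter (P? ∘ (false ∷_)) As) ≡
    (ι b * W adj′ (allFin n) (o ∘ suc) (i ∘ suc)) k
  without true  oz = ≡.trans
    (rec (i ∘ suc) k (P? ∘ (false ∷_)) (Counted-false⁻ ∘ to) (from ∘ Counted-false⁺ oz))
    (≡.sym (at (*-identityˡ _) k))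
  without false oz = ≡.trans
    (count-none (P? ∘ (false ∷_)) As (λ A p →
      contradiction (≡.trans (≡.sym (outside (to p) zero (λ ()))) oz) λ ()))
    (≡.sym (at (zeroˡ _) k))

  with-zero : ∀ b → i zero ≡ b → ∀ j → k ≡ j → length (filter (P? ∘ (true ∷_)) As) ≡
    (ι b * (X * W adj′ (allFin n) (o ∘ suc) ((i ∖ adj zero) ∘ suc))) j
  with-zero false iz j _ = ≡.trans
    (count-none (P? ∘ (true ∷_)) As (λ A p →
      contradiction (≡.trans (≡.sym (inside (to p) zero here)) iz) λ ()))
    (≡.sym (at (zeroˡ _) j))
  -- No set of size 0 contains `zero`, and the factor `X` kills the constant coefficient.
  with-zero true iz zero k≡ = ≡.trans
    (count-none (P? ∘ (true ∷_)) As (λ A p →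
      contradiction (≡.trans (size-k (to p)) k≡) λ ()))
    ≡.refl
  with-zero true iz (suc j) ≡.refl = ≡.trans
    (rec ((i ∖ adj zero) ∘ suc) j (P? ∘ (true ∷_)) (Counted-true⁻ ∘ to)
      (from ∘ Counted-true⁺ irr symm iz))
    (≡.sym (≡.trans (at (*-identityˡ _) (suc j)) (X*-suc _ j)))

-- Vertices of the perfect tree as words: [] is the root and c ∷ p is the c-th child
-- of p, so that the words ending in a fixed letter form a branch at the root.

module Words (s : ℕ) where

  open Polynomials s

  Word : Set
  Word = List (Fin r)

  infix 4 _≟_
  _≟_ : (p q : Word) → Dec (p ≡ q)
  _≟_ = List.≡-dec Fin._≟_

  child : Word → Word → Bool
  child p []      = false
  child p (c ∷ q) = does (p ≟ q)

  adj : Word → Word → Bool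
  adj p q = child p q ∨ child q p

  tree : ℕ → List Word
  branches : ℕ → Fin r → List Word
  tree zero    = []
  tree (suc h) = [] ∷ concat (tabulate (branches h))
  branches h c = map (_∷ʳ c) (tree h)

  adj-sym : ∀ p q → adj p q ≡ adj q p
  adj-sym p q = Bool.∨-comm (child p q) (child q p)

  child-irrefl : ∀ p → child p p ≡ false
  child-irrefl []      = ≡.refl
  child-irrefl (c ∷ p) = dec-false (c ∷ p ≟ p)
    (λ eq → contradiction (cong length eq) (ℕ.<⇒≢ (ℕ.n<1+n _) ∘ ≡.sym))

  adj-irrefl : ∀ p → adj p p ≡ false
  adj-irrefl p = cong₂ _∨_ (child-irrefl p) (child-irrefl p)

  ∷ʳ≟[] : ∀ p c → does (p ∷ʳ c ≟ []) ≡ false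
  ∷ʳ≟[] []      c = ≡.refl
  ∷ʳ≟[] (_ ∷ p) c = ≡.refl

  []≟∷ʳ : ∀ p c → does ([] ≟ p ∷ʳ c) ≡ false
  []≟∷ʳ []      c = ≡.refl
  []≟∷ʳ (_ ∷ p) c = ≡.refl

  ≟-∷ʳ : ∀ p q c → does (p ∷ʳ c ≟ q ∷ʳ c) ≡ does (p ≟ q)
  ≟-∷ʳ p q c = does-⇔ (mk⇔ (List.∷ʳ-injectiveˡ p q) (cong (_∷ʳ c)))
    (p ∷ʳ c ≟ q ∷ʳ c) (p ≟ q)

  ≟-∷ʳ-≢ : ∀ p q {c d} → c ≢ d → does (p ∷ʳ c ≟ q ∷ʳ d) ≡ false
  ≟-∷ʳ-≢ p q c≢d = dec-false (p ∷ʳ _ ≟ q ∷ʳ _) (c≢d ∘ List.∷ʳ-injectiveʳ p q)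

  child-∷ʳ : ∀ p q c → child (p ∷ʳ c) (q ∷ʳ c) ≡ child p q
  child-∷ʳ p []      c = ∷ʳ≟[] p c
  child-∷ʳ p (_ ∷ q) c = ≟-∷ʳ p q c

  child-∷ʳ-≢ : ∀ p q {c d} → c ≢ d → child (p ∷ʳ c) (q ∷ʳ d) ≡ false
  child-∷ʳ-≢ p []      c≢d = ∷ʳ≟[] p _
  child-∷ʳ-≢ p (_ ∷ q) c≢d = ≟-∷ʳ-≢ p q c≢d

  adj-∷ʳ : ∀ c p q → adj (p ∷ʳ c) (q ∷ʳ c) ≡ adj p q
  adj-∷ʳ c p q = cong₂ _∨_ (child-∷ʳ p q c) (child-∷ʳ q p c)

  adj-branches : ∀ h {c d u v} → c ≢ d → u ∈ branches h c → v ∈ branches h d → adj u v ≡ false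
  adj-branches h {c} {d} c≢d u∈ v∈
    with p , _ , ≡.refl ← ∈-map⁻ (_∷ʳ c) u∈ | q , _ , ≡.refl ← ∈-map⁻ (_∷ʳ d) v∈
    = cong₂ _∨_ (child-∷ʳ-≢ p q c≢d) (child-∷ʳ-≢ q p (c≢d ∘ ≡.sym))

  null-∷ʳ : ∀ (p : Word) c → null (p ∷ʳ c) ≡ false
  null-∷ʳ []      c = ≡.refl
  null-∷ʳ (_ ∷ p) c = ≡.refl

  -- Only the top of a branch is adjacent to the root, so taking the root amounts to deleting `null`
  -- in every branch.
  adj-root : ∀ p c → adj [] (p ∷ʳ c) ≡ null p
  adj-root []      c = ≡.refl
  adj-root (d ∷ p) c = cong (_∨ false) ([]≟∷ʳ p c)

  -- Generating functions of the perfect tree and of its stars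

  Wᵗ : ℕ → (o i : Word → Bool) → Series
  Wᵗ h o i = W adj (tree h) o i

  Wᵗ-cong : ∀ h {o o′ i i′} → (∀ u → o u ≡ o′ u) → (∀ u → i u ≡ i′ u) →
    Wᵗ h o i ≈ Wᵗ h o′ i′
  Wᵗ-cong h p q = W-cong (tree h) (λ _ _ → ≡.refl) (λ _ → p _) (λ _ → q _)

  W-branches : ∀ h {o i} → W adj (concat (tabulate (branches h))) o i ≈
    ∏ (λ c → Wᵗ h (o ∘ (_∷ʳ c)) (i ∘ (_∷ʳ c)))
  W-branches h {o} {i} = trans (W-concat (branches h) (adj-branches h)) (∏-cong {r} λ c →
    trans (reflexive (W-map {adj = adj} (_∷ʳ c) (tree h) {o} {i}))
          (W-cong (tree h) (adj-∷ʳ c) (λ _ → ≡.refl) (λ _ → ≡.refl)))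

  any : Word → Bool
  any _ = true

  -- No edges join distinct branches and each branch is a copy of the smaller tree, so either choice
  -- at the root leaves a product.
  Wᵗ-suc : ∀ h {o i} → Wᵗ (suc h) o i ≈
    (ι (o []) * ∏ (λ c → Wᵗ h (o ∘ (_∷ʳ c)) (i ∘ (_∷ʳ c))) +
     ι (i []) * (X * ∏ (λ c → Wᵗ h (o ∘ (_∷ʳ c)) ((i ∘ (_∷ʳ c)) ∖ null))))
  Wᵗ-suc h {o} {i} = +-cong (*-congˡ (W-branches h))
    (*-congˡ (*-congˡ (trans (W-branches h) (∏-cong {r} λ c →
      Wᵗ-cong h {o ∘ (_∷ʳ c)} (λ _ → ≡.refl) (λ u → cong (λ b → i (u ∷ʳ c) ∧ not b) (adj-root u c))))))

  Wᵗ≈PQ : ∀ h → (Wᵗ h any any ≈ P h) × (Wᵗ h any (any ∖ null) ≈ Q h)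
  Wᵗ≈PQ zero    = refl , refl
  Wᵗ≈PQ (suc h) with Wᵗ≈PQ h
  ... | p , q =
    trans (Wᵗ-suc h) (+-cong
      (trans (*-identityˡ _) (∏-const {r} λ c → p))
      (trans (*-identityˡ _) (*-congˡ (∏-const {r} λ c → q)))) ,
    trans (Wᵗ-suc h) (trans (+-cong
        (trans (*-identityˡ _) (∏-const {r} λ c →
          trans (Wᵗ-cong h (λ _ → ≡.refl) (λ u → cong not (null-∷ʳ u c))) p))
        (zeroˡ _))
      (+-identityʳ _))

  length-∷ʳ : ∀ (p : Word) c → length (p ∷ʳ c) ≡ suc (length p)
  length-∷ʳ p c = ≡.trans (List.length-++ p) (ℕ.+-comm (length p) 1)

  -- Allowing every vertex except v to be left out singles out the star of v.
  except : Word → Word → Bool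
  except v u = not (does (u ≟ v))

  -- The last letter of `v` names the branch of the root that holds `v`. Only that branch carries
  -- the star; each of the other `s` gives `P h` or `Q h`.
  Wᵗ≈S : ∀ h v → length v ℕ.< h →
    (Wᵗ h (except v) any ≈ S h (length v)) × (Wᵗ h (except v) (any ∖ null) ≈ S⁰ h (length v))
  Wᵗ≈S (suc h) v v<h with List.initLast v
  ... | [] =
    trans (Wᵗ-suc h) (trans (+-cong (zeroˡ _) (trans (*-identityˡ _) (*-congˡ
        (∏-const {r} λ c → trans (Wᵗ-cong h (λ u → cong not (∷ʳ≟[] u c)) (λ _ → ≡.refl))
                             (proj₂ (Wᵗ≈PQ h))))))
      (+-identityˡ _)) ,
    trans (Wᵗ-suc h) (trans (+-cong (zeroˡ _) (zeroˡ _)) (+-identityˡ _))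
  ... | p List.∷ʳ′ c rewrite length-∷ʳ p c with Wᵗ≈S h p (ℕ.s<s⁻¹ v<h)
  ... | star , star⁰ =
    trans (Wᵗ-suc h) (+-cong
      (trans (*-cong root-free (∏-except any (proj₁ (Wᵗ≈PQ h)) star)) (*-identityˡ _))
      (trans (*-identityˡ _) (trans (*-congˡ (∏-except (any ∖ null) (proj₂ (Wᵗ≈PQ h)) star⁰))
        (sym (*-assoc _ _ _))))) ,
    trans (Wᵗ-suc h) (trans (+-cong
        (trans (*-cong root-free (trans
            (∏-cong {r} λ d → Wᵗ-cong h {except (p ∷ʳ c) ∘ (_∷ʳ d)} (λ _ → ≡.refl) (λ u → cong not (null-∷ʳ u d)))
            (∏-except any (proj₁ (Wᵗ≈PQ h)) star)))
          (*-identityˡ _))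
        (zeroˡ _))
      (+-identityʳ _))
    where
    root-free : ι (except (p ∷ʳ c) []) ≈ 1#
    root-free = reflexive (cong (ι ∘ not) ([]≟∷ʳ p c))

    ∏-except : ∀ i {f g} → Wᵗ h any i ≈ f → Wᵗ h (except p) i ≈ g →
      ∏ (λ d → Wᵗ h (except (p ∷ʳ c) ∘ (_∷ʳ d)) i) ≈ f ^ s * g
    ∏-except i eqᶠ eqᵍ = ∏-const-except c
      (trans (Wᵗ-cong h (λ u → cong not (≟-∷ʳ u p c)) (λ _ → ≡.refl)) eqᵍ)
      (λ c≢d → trans
        (Wᵗ-cong h (λ u → cong not (≟-∷ʳ-≢ u p (c≢d ∘ ≡.sym))) (λ _ → ≡.refl)) eqᶠ)

  -- The enumeration `tree` and the heap numbering of words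

  ∈-tree⁺ : ∀ h p → length p ℕ.< h → p ∈ tree h
  ∈-tree⁺ (suc h) p p<h with List.initLast p
  ... | [] = here ≡.refl
  ... | q List.∷ʳ′ c rewrite length-∷ʳ q c = there (∈-concat⁺′
    (∈-map⁺ (_∷ʳ c) (∈-tree⁺ h q (ℕ.s<s⁻¹ p<h))) (∈-tabulate⁺ {f = branches h} c))

  ∈-branches⁻ : ∀ h {p} → p ∈ concat (tabulate (branches h)) →
    ∃ λ c → ∃ λ q → q ∈ tree h × p ≡ q ∷ʳ c
  ∈-branches⁻ h p∈
    with vs , p∈vs , vs∈ ← ∈-concat⁻′ (tabulate (branches h)) p∈
    with c , ≡.refl ← ∈-tabulate⁻ {f = branches h} vs∈
    = c , ∈-map⁻ (_∷ʳ c) p∈vs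

  ∈-tree⁻ : ∀ h {p} → p ∈ tree h → length p ℕ.< h
  ∈-tree⁻ (suc h) (here ≡.refl) = s≤s z≤n
  ∈-tree⁻ (suc h) (there p∈) with c , q , q∈ , ≡.refl ← ∈-branches⁻ h p∈
    rewrite length-∷ʳ q c = s≤s (∈-tree⁻ h q∈)

  tree-unique : ∀ h → Unique (tree h)
  tree-unique zero    = []
  tree-unique (suc h) =
    All.tabulate root∉ ∷ Unique.concat⁺
      (All.tabulate⁺ λ c → Unique.map⁺ (λ {p} {q} → List.∷ʳ-injectiveˡ {x = c} {y = c} p q) (tree-unique h))
      (AllPairs.tabulate⁺ disjoint)
    where
    root∉ : ∀ {p} → p ∈ concat (tabulate (branches h)) → [] ≢ p
    root∉ p∈ ≡.refl with c , q , _ , eq ← ∈-branches⁻ h p∈ = contradiction (≡.trans (cong length eq) (length-∷ʳ q c)) λ ()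

    disjoint : ∀ {c d} → c ≢ d → Disjoint (branches h c) (branches h d)
    disjoint {c} {d} c≢d (p∈ , p∈′)
      with q , _ , ≡.refl ← ∈-map⁻ (_∷ʳ c) p∈ | q′ , _ , eq ← ∈-map⁻ (_∷ʳ d) p∈′
      = c≢d (List.∷ʳ-injectiveʳ q q′ eq)

  -- The heap number of a word is its value as a numeral in bijective base r.
  num : Word → ℕ
  num []      = 0
  num (c ∷ p) = r ℕ.* num p ℕ.+ suc (toℕ c)

  -- Digits run from 1 to `r`; after subtracting 1, the first letter is the remainder modulo `r` and
  -- the number of the tail is the quotient.
  num-injective : ∀ p q → num p ≡ num q → p ≡ q
  num-injective []      []      eq = ≡.refl
  num-injective []      (d ∷ q) eq = contradiction (≡.trans eq (ℕ.+-suc _ _)) λ ()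
  num-injective (c ∷ p) []      eq = contradiction (≡.trans (≡.sym eq) (ℕ.+-suc _ _)) λ ()
  num-injective (c ∷ p) (d ∷ q) eq = cong₂ _∷_ (Fin.toℕ-injective c≡d) (num-injective p q p≡q)
    where
    digit+ : ∀ (c : Fin r) m → suc (toℕ c ℕ.+ m ℕ.* r) ≡ r ℕ.* m ℕ.+ suc (toℕ c)
    digit+ c m = ≡.trans (ℕ.+-comm (suc (toℕ c)) (m ℕ.* r))
                         (cong (ℕ._+ suc (toℕ c)) (ℕ.*-comm m r))

    eq′ : toℕ c ℕ.+ num p ℕ.* r ≡ toℕ d ℕ.+ num q ℕ.* r
    eq′ = ℕ.suc-injective (≡.trans (digit+ c (num p)) (≡.trans eq (≡.sym (digit+ d (num q)))))

    mod : ∀ (c : Fin r) m → (toℕ c ℕ.+ m ℕ.* r) ℕ.% r ≡ toℕ c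
    mod c m = ≡.trans (ℕ.[m+kn]%n≡m%n (toℕ c) m r) (ℕ.m<n⇒m%n≡m (Fin.toℕ<n c))

    c≡d : toℕ c ≡ toℕ d
    c≡d = ≡.trans (≡.sym (mod c (num p))) (≡.trans (cong (ℕ._% r) eq′) (mod d (num q)))

    p≡q : num p ≡ num q
    p≡q = ℕ.*-cancelʳ-≡ (num p) (num q) r (ℕ.+-cancelˡ-≡ (toℕ c) _ _
      (≡.trans eq′ (cong (ℕ._+ num q ℕ.* r) (≡.sym c≡d))))

  num<size : ∀ h p → length p ℕ.< h → num p ℕ.< size r h
  num<size (suc h) []      _         = s≤s z≤n
  num<size (suc h) (c ∷ p) (s≤s p<h) = s≤s (begin
    r ℕ.* num p ℕ.+ suc (toℕ c) ≤⟨ ℕ.+-monoʳ-≤ (r ℕ.* num p) (Fin.toℕ<n c) ⟩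
    r ℕ.* num p ℕ.+ r           ≡⟨ ℕ.+-comm (r ℕ.* num p) r ⟩
    r ℕ.+ r ℕ.* num p           ≡⟨ ℕ.*-suc r (num p) ⟨
    r ℕ.* suc (num p)           ≤⟨ ℕ.*-monoʳ-≤ r (num<size h p p<h) ⟩
    r ℕ.* size r h              ∎)
    where open ℕ.≤-Reasoning

  decode : ∀ h n → n ℕ.< size r h → ∃ λ p → length p ℕ.< h × num p ≡ n
  decode (suc h) zero    _         = [] , s≤s z≤n , ≡.refl
  decode (suc h) (suc n) (s≤s n<) =
    -- Since digits start at 1, it is `n`, not `suc n`, that is divided by `r`.
    let p , p<h , eq = decode h (n ℕ./ r) (ℕ.m<n*o⇒m/o<n (≡.subst (n ℕ.<_) (ℕ.*-comm r _) n<))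
        c = fromℕ< (ℕ.m%n<n n r)
    in c ∷ p , s≤s p<h , (begin
      r ℕ.* num p ℕ.+ suc (toℕ c)       ≡⟨ cong₂ (λ m d → r ℕ.* m ℕ.+ suc d) eq (Fin.toℕ-fromℕ< _) ⟩
      r ℕ.* (n ℕ./ r) ℕ.+ suc (n ℕ.% r) ≡⟨ ℕ.+-suc _ _ ⟩
      suc (r ℕ.* (n ℕ./ r) ℕ.+ n ℕ.% r) ≡⟨ cong suc (ℕ.+-comm _ (n ℕ.% r)) ⟩
      suc (n ℕ.% r ℕ.+ r ℕ.* (n ℕ./ r)) ≡⟨ cong (λ m → suc (n ℕ.% r ℕ.+ m)) (ℕ.*-comm r (n ℕ./ r)) ⟩
      suc (n ℕ.% r ℕ.+ n ℕ./ r ℕ.* r)   ≡⟨ cong suc (ℕ.m≡m%n+[m/n]*n n r) ⟨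
      suc n                             ∎)
    where open ≡.≡-Reasoning

  -- Transfer from numbered vertices to words

  module _ (h : ℕ) where

    word : PTree r h → Word
    word x = proj₁ (decode h (toℕ x) (Fin.toℕ<n x))

    length-word : ∀ x → length (word x) ℕ.< h
    length-word x = proj₁ (proj₂ (decode h (toℕ x) (Fin.toℕ<n x)))

    num-word : ∀ x → num (word x) ≡ toℕ x
    num-word x = proj₂ (proj₂ (decode h (toℕ x) (Fin.toℕ<n x)))

    word-injective : ∀ {x y} → word x ≡ word y → x ≡ y
    word-injective {x} {y} eq = Fin.toℕ-injective
      (≡.trans (≡.sym (num-word x)) (≡.trans (cong num eq) (num-word y)))

    -- Both lists are duplicate-free with the same members: a word `p` of the tree is the word of
    -- the vertex numbered `num p`.
    words↭tree : map word (allFin (size r h)) ↭ tree h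
    words↭tree = ∼bag⇒↭ (unique∧set⇒bag
      (Unique.map⁺ word-injective (Unique.allFin⁺ _)) (tree-unique h) (mk⇔ to from))
      where
      to : ∀ {p} → p ∈ map word (allFin (size r h)) → p ∈ tree h
      to p∈ with x , _ , ≡.refl ← ∈-map⁻ word p∈ = ∈-tree⁺ h (word x) (length-word x)

      from : ∀ {p} → p ∈ tree h → p ∈ map word (allFin (size r h))
      from {p} p∈ = ≡.subst (_∈ map word (allFin (size r h)))
        (num-injective _ _ (≡.trans (num-word (fromℕ< p<)) (Fin.toℕ-fromℕ< p<)))
        (∈-map⁺ word (∈-allFin (fromℕ< p<)))
        where p< = num<size h p (∈-tree⁻ h p∈)

    child⁺ : ∀ x y → Child r h x y → child (word x) (word y) ≡ true
    child⁺ x y (c , eq) = ≡.trans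
      (cong (child (word x)) (num-injective (word y) (c ∷ word x) (≡.trans (num-word y)
        (≡.trans eq (cong (λ m → r ℕ.* m ℕ.+ suc (toℕ c)) (≡.sym (num-word x)))))))
      (dec-true (word x ≟ word x) ≡.refl)

    child⁻ : ∀ x y → child (word x) (word y) ≡ true → Child r h x y
    child⁻ x y eq with word y in wy
    -- `eq` rules out an empty `word y` and a tail `p` other than `word x`; the head `c` is the
    -- index of the child.
    child⁻ x y eq | c ∷ p with word x ≟ p
    ... | yes wx = c , ≡.trans (≡.sym (num-word y)) (≡.trans (cong num wy)
      (cong (λ m → r ℕ.* m ℕ.+ suc (toℕ c))
        (≡.trans (cong num (≡.sym wx)) (num-word x))))

    adj⁺ : ∀ x y → ¬ Adj r h x y → adj (word x) (word y) ≡ false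
    adj⁺ x y ¬a = cong₂ _∨_ (Bool.¬-not (¬a ∘ inj₁ ∘ child⁻ x y))
                            (Bool.¬-not (¬a ∘ inj₂ ∘ child⁻ y x))

    adj⁻ : ∀ x y → adj (word x) (word y) ≡ false → ¬ Adj r h x y
    adj⁻ x y eq (inj₁ c) with () ← ≡.trans (≡.sym (cong (_∨ child (word y) (word x)) (child⁺ x y c))) eq
    adj⁻ x y eq (inj₂ c) with () ← ≡.trans (≡.sym (≡.trans
      (cong (child (word x) (word y) ∨_) (child⁺ y x c)) (Bool.∨-zeroʳ _))) eq

    -- `except (word v)` forbids leaving `v` out, which turns `Counted` into `InStar`; the
    -- permutation then moves the sum to `tree`.
    starSize≡S : ∀ k v → starSize r h k v ≡ S h (length (word v)) k
    starSize≡S k v = begin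
      starSize r h k v
        ≡⟨ count≡W (size r h) (λ x y → adj (word x) (word y)) (adj-irrefl ∘ word)
             (λ x y → adj-sym (word x) (word y)) (except (word v) ∘ word) (const true) k
             (inStar? r h k v) to from ⟩
      W (λ x y → adj (word x) (word y)) (allFin (size r h)) (except (word v) ∘ word) (const true) k
        ≡⟨ cong (λ f → f k) (W-map word (allFin (size r h))) ⟨
      W adj (map word (allFin (size r h))) (except (word v)) any k
        ≡⟨ at (W-↭ adj-sym words↭tree) k ⟩
      Wᵗ h (except (word v)) any k
        ≡⟨ at (proj₁ (Wᵗ≈S h (word v) (length-word v))) k ⟩
      S h (length (word v)) k ∎
      where
      open ≡.≡-Reasoning
      C = Counted (λ x y → adj (word x) (word y)) (except (word v) ∘ word) (const true) k

      to : ∀ {A} → InStar r h k v A → C A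
      to (ind , card , v∈) = record
        { independent = λ x y x∈ y∈ → adj⁺ x y (ind x y x∈ y∈)
        ; size-k  = card
        ; outside = λ u u∉ → cong not (dec-false (word u ≟ word v)
            (λ eq → u∉ (≡.subst (Subset._∈ _) (≡.sym (word-injective eq)) v∈)))
        ; inside  = λ _ _ → ≡.refl }

      from : ∀ {A} → C A → InStar r h k v A
      from {A} c = (λ x y x∈ y∈ → adj⁻ x y (independent c x y x∈ y∈)) , size-k c , v∈
        where
        v∈ : v Subset.∈ A
        v∈ with v ∈? A
        ... | yes p = p
        ... | no v∉ = contradiction
          (≡.trans (≡.sym (cong not (dec-true (word v ≟ word v) ≡.refl))) (outside c v v∉)) λ ()

theorem1 : ∀ (r h k : ℕ) → 2 ≤ r → 1 ≤ h → 1 ≤ k →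
    (v ℓ : PTree r h) → IsLeaf r h ℓ →
    starSize r h k v ≤ starSize r h k ℓ
theorem1 (suc s) (suc m) k _ _ _ v ℓ leaf = begin
  starSize (suc s) (suc m) k v             ≡⟨ starSize≡S (suc m) k v ⟩
  S (suc m) (length (word (suc m) v)) k    ≤⟨ ≼-at (proj₁ (S≼leaf m _ (depth≤ v))) k ⟩
  S (suc m) m k                            ≡⟨ cong (λ n → S (suc m) n k) leaf-depth ⟨
  S (suc m) (length (word (suc m) ℓ)) k    ≡⟨ starSize≡S (suc m) k ℓ ⟨
  starSize (suc s) (suc m) k ℓ             ∎
  where
  open ℕ.≤-Reasoning
  open Polynomials s using (S; S≼leaf)
  open Words s

  depth≤ : ∀ x → length (word (suc m) x) ≤ m
  depth≤ x = ℕ.s≤s⁻¹ (length-word (suc m) x)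

  -- A word shorter than `m` has a number below `size (suc s) m`, where the numbers of the leaves
  -- begin.
  leaf-depth : length (word (suc m) ℓ) ≡ m
  leaf-depth = ℕ.≤-antisym (depth≤ ℓ) (ℕ.≮⇒≥ λ d<m → ℕ.<⇒≱
    (≡.subst (ℕ._< size (suc s) m) (num-word (suc m) ℓ) (num<size m (word (suc m) ℓ) d<m)) leaf)
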